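{- Algorithm SE-A runs in time $\mathcal{O}(nz)$ to create a graph of $n$ vertices using a selection of $z\ge 1$ edges in each round (with an absolute implied constant).
   Context: **Random systematic sampling (RSS).** Input: distinct elements $x_1,\dots,x_N$ with positive integer frequencies $d_1,\dots,d_N$, $s=\sum_i d_i$, and a sample size $m$ dividing $s$ (here always $d_i\le s/m$). Shuffle the elements uniformly at random, draw $r$ uniformly from $[0,s/m)$, set $psum=0$, and scan $i=1,\dots,N$: add $d_i$ to $psum$, and if $psum>r$, output $x_i$ and increase $r$ by $s/m$. **Algorithm SE-A** (parameter $z\ge1$, target order $n$, initial connected simple graph $\mathcal{G}_0$ with at least one edge). Start with $(V,E)=\mathcal{G}_0$. While $|V|<n$, perform a round: (1) select $z$ edges of $E$ independently and uniformly at random, with replacement; (2) form the bag of endpoints of these $z$ edges, each vertex with frequency equal to the number of selected edges (with multiplicity) containing it, and apply RSS with sample size $2$ to get a pair $\{u,w\}$; (3) add a new vertex $v$ to $V$ and the edges $\{v,u\},\{v,w\}$ to $E$. **Cost model.** Unit-cost RAM: drawing a uniform random number, accessing an edge by index, updating a counter indexed by a vertex, and appending a vertex or edge each take constant time; shuffling $N$ elements takes time $O(N)$. The running time is the worst-case total time of all rounds (the growth process). -}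

module Defs where

open import Data.Bool using (if_then_else_)
open import Data.Fin using (Fin; toℕ; fromℕ; inject₁)
open import Data.Fin.Permutation using (Permutation′; _⟨$⟩ʳ_)
open import Data.List using (List; []; _∷_; length; tabulate) renaming (lookup to lookupᴸ; map to mapᴸ)
open import Data.Nat using (ℕ; zero; suc; _+_; _*_; _/_; _≤_; _<_; _<ᵇ_; _≡ᵇ_; NonZero)
open import Data.Product using (_×_; _,_; ∃-syntax; map; proj₁; proj₂)
open import Data.Sum using (_⊎_)
open import Data.Unit using (⊤; tt)
open import Data.Vec using (Vec; lookup; _[_]≔_; replicate; _∷ʳ_) renaming (map to mapⱽ)
open import Relation.Binary.Construct.Closure.ReflexiveTransitive using (Star)
open import Relation.Binary.PropositionalEquality using (_≡_; _≢_)
open import Relation.Nullary using (¬_)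

-- `elementary` covers arithmetic, comparisons and branching on registers.
data Instr : Set where
  edgeAccess counterAccess append elementary : Instr

-- Decision tree of a program: `charge` executes one deterministic
-- instruction, `uniform k` branches on a uniform element of {0,…,k-1},
-- `permute N` on a uniform permutation of N positions.
data Prog (A : Set) : Set where
  return  : A → Prog A
  charge  : Instr → Prog A → Prog A
  uniform : (k : ℕ) .{{_ : NonZero k}} → (Fin k → Prog A) → Prog A
  permute : (N : ℕ) → (Permutation′ N → Prog A) → Prog A

infixl 1 _>>=_ _>>_

_>>=_ : ∀ {A B : Set} → Prog A → (A → Prog B) → Prog B
return a    >>= g = g a
charge i p  >>= g = charge i (p >>= g)
uniform k f >>= g = uniform k (λ i → f i >>= g)
permute N f >>= g = permute N (λ π → f π >>= g)

_>>_ : ∀ {A B : Set} → Prog A → Prog B → Prog B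
p >> q = p >>= λ _ → q

-- The constants are arbitrary: an operation takes constant time when its
-- cost does not depend on the graph, on the target order or on z.
record CostModel : Set where
  field
    instr          : Instr → ℕ
    draw           : ℕ
    shuffle        : ℕ → ℕ
    shuffle-linear : ∃[ c ] (∀ N → 1 ≤ N → shuffle N ≤ c * N)

-- M ⊢ p ⇓ a ⟨ t ⟩: for some outcome of the random choices, p returns a
-- after time t.
data _⊢_⇓_⟨_⟩ (M : CostModel) {A : Set} : Prog A → A → ℕ → Set where
  return  : ∀ {a} → M ⊢ return a ⇓ a ⟨ 0 ⟩
  charge  : ∀ {i p a t} → M ⊢ p ⇓ a ⟨ t ⟩ →
            M ⊢ charge i p ⇓ a ⟨ CostModel.instr M i + t ⟩
  uniform : ∀ {k} .{{_ : NonZero k}} {f a t} (i : Fin k) → M ⊢ f i ⇓ a ⟨ t ⟩ →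
            M ⊢ uniform k f ⇓ a ⟨ CostModel.draw M + t ⟩
  permute : ∀ {N f a t} (π : Permutation′ N) → M ⊢ f π ⇓ a ⟨ t ⟩ →
            M ⊢ permute N f ⇓ a ⟨ CostModel.shuffle M N + t ⟩

exec : ∀ {A : Set} → Instr → A → Prog A
exec i a = charge i (return a)

eval : ∀ {A : Set} → A → Prog A
eval = exec elementary

draw : (k : ℕ) .{{_ : NonZero k}} → Prog (Fin k)
draw k = uniform k return

shuffle : ∀ {A : Set} → List A → Prog (List A)
shuffle xs = permute (length xs) λ π →
  return (tabulate (λ i → lookupᴸ xs (π ⟨$⟩ʳ i)))

total : ∀ {A : Set} → List (A × ℕ) → Prog ℕ
total []             = return 0
total ((_ , d) ∷ xs) = do
  s ← total xs
  eval (d + s)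

scan : ∀ {A : Set} (step r psum : ℕ) → List (A × ℕ) → Prog (List A)
scan step r psum []             = return []
scan step r psum ((x , d) ∷ xs) = do
  psum′ ← eval (psum + d)
  hit   ← eval (r <ᵇ psum′)
  if hit
    then (do r′  ← eval (r + step)
             out ← scan step r′ psum′ xs
             exec append (x ∷ out))
    else scan step r psum′ xs

-- The partial sums and s/m are integers, so a real r in [0, s/m) gives the
-- same output as ⌊r⌋, which is uniform on {0,…,s/m-1}.  Valid inputs
-- (m ∣ s and s > 0) have s/m ≥ 1; the clause for zero only makes the
-- function total.
rss : ∀ {A : Set} (m : ℕ) .{{_ : NonZero m}} → List (A × ℕ) → Prog (List A)
rss {A} m bag = do
  s    ← total bag
  step ← eval (s / m)
  xs   ← shuffle bag
  start step xs
  where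
  start : ℕ → List (A × ℕ) → Prog (List A)
  start zero          xs = return []
  start step@(suc _)  xs = do
    r ← draw step
    scan step (toℕ r) 0 xs

Edge : ℕ → Set
Edge k = Fin k × Fin k

-- Graphs have at least one edge; the orientation of the stored pairs is
-- irrelevant.
record Graph (k : ℕ) : Set where
  field
    size             : ℕ
    {{size-nonZero}} : NonZero size
    edges            : Vec (Edge k) size

SameEdge : ∀ {k} → Edge k → Edge k → Set
SameEdge (u , v) (u′ , v′) = (u ≡ u′ × v ≡ v′) ⊎ (u ≡ v′ × v ≡ u′)

module _ {k} (G : Graph k) where
  open Graph G

  record Simple : Set where
    field
      loopless   : ∀ i → proj₁ (lookup edges i) ≢ proj₂ (lookup edges i)
      noParallel : ∀ i j → i ≢ j → ¬ SameEdge (lookup edges i) (lookup edges j)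

  Adjacent : Fin k → Fin k → Set
  Adjacent u v = ∃[ i ] SameEdge (lookup edges i) (u , v)

  Connected : Set
  Connected = ∀ u v → Star Adjacent u v

-- The array of counters, one per vertex, is all zero between rounds: each
-- round pays for resetting the counters it has used.
record State (k : ℕ) : Set where
  constructor ⟨_,_⟩
  field
    graph    : Graph k
    counters : Vec ℕ k

start : ∀ {k} → Graph k → State k
start {k} G = ⟨ G , replicate k 0 ⟩

selectEdges : ∀ {k} → ℕ → Graph k → Prog (List (Edge k))
selectEdges zero    G = return []
selectEdges (suc z) G = do
  i  ← draw size
  e  ← exec edgeAccess (lookup edges i)
  es ← selectEdges z G
  exec append (e ∷ es)
  where open Graph G

readCounter : ∀ {k} → Vec ℕ k → Fin k → Prog ℕ
readCounter cs v = exec counterAccess (lookup cs v)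

writeCounter : ∀ {k} → Vec ℕ k → Fin k → ℕ → Prog (Vec ℕ k)
writeCounter cs v c = exec counterAccess (cs [ v ]≔ c)

-- The list records the vertices whose counter is nonzero, without repetition.
tally : ∀ {k} → Fin k → Vec ℕ k × List (Fin k) → Prog (Vec ℕ k × List (Fin k))
tally v (cs , seen) = do
  c     ← readCounter cs v
  cs′   ← writeCounter cs v (suc c)
  fresh ← eval (c ≡ᵇ 0)
  if fresh then exec append (cs′ , v ∷ seen) else return (cs′ , seen)

tallyEdges : ∀ {k} → List (Edge k) → Vec ℕ k × List (Fin k) →
             Prog (Vec ℕ k × List (Fin k))
tallyEdges []             st = return st
tallyEdges ((u , v) ∷ es) st = do
  st₁ ← tally u st
  st₂ ← tally v st₁
  tallyEdges es st₂

-- Reads off the frequencies of the listed vertices and resets their counters.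
collect : ∀ {k} → List (Fin k) → Vec ℕ k → Prog (List (Fin k × ℕ) × Vec ℕ k)
collect []       cs = return ([] , cs)
collect (v ∷ vs) cs = do
  d           ← readCounter cs v
  cs′         ← writeCounter cs v 0
  (bag , cs″) ← collect vs cs′
  exec append ((v , d) ∷ bag , cs″)

-- The new vertex is fromℕ k.  The old ones keep their numbers, so inject₁
-- changes only their type and costs nothing.
addVertex : ∀ {k} → State k → Prog (State (suc k))
addVertex ⟨ G , cs ⟩ = exec append
  ⟨ record { size = size ; edges = mapⱽ (map inject₁ inject₁) edges } , cs ∷ʳ 0 ⟩
  where open Graph G

addEdge : ∀ {k} → Fin k → Fin k → State k → Prog (State k)
addEdge v u ⟨ G , cs ⟩ = exec append
  ⟨ record { size = suc size ; edges = edges ∷ʳ (v , u) } , cs ⟩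
  where open Graph G

addEdges : ∀ {k} → Fin k → List (Fin k) → State k → Prog (State k)
addEdges v []       S = return S
addEdges v (u ∷ us) S = do
  S′ ← addEdge v u S
  addEdges v us S′

-- The bag has total frequency 2z and every frequency is at most z, so rss 2
-- returns exactly two vertices.
round : ∀ {k} → ℕ → State k → Prog (State (suc k))
round {k} z ⟨ G , cs ⟩ = do
  es           ← selectEdges z G
  (cs₁ , seen) ← tallyEdges es (cs , [])
  (bag , cs₂)  ← collect seen cs₁
  pair         ← rss 2 bag
  S            ← addVertex ⟨ G , cs₂ ⟩
  addEdges (fromℕ k) (mapᴸ inject₁ pair) S

-- HaltsWithin M n z S t: from state S, for all outcomes of the random
-- choices, the loop `while |V| < n do round` terminates and its rounds take
-- total time at most t.  The successful test of the loop condition is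
-- charged to the round it starts.
data HaltsWithin (M : CostModel) (n z : ℕ) {k : ℕ} (S : State k) (t : ℕ) : Set where
  stop : n ≤ k → HaltsWithin M n z S t
  loop : k < n →
         (∀ {S′ c} → M ⊢ eval (k <ᵇ n) >> round z S ⇓ S′ ⟨ c ⟩ →
           ∃[ t′ ] (c + t′ ≤ t × HaltsWithin M n z S′ t′)) →
         HaltsWithin M n z S t

{-# OPTIONS --safe #-}

-- Measure time in a unit K that bounds every constant of the cost model, so
-- that shuffling N elements takes at most 1 + N units.  For z selected edges
-- at most 2z vertices are tallied, whatever the counters contained before,
-- hence the bag and the RSS output have at most 2z entries.  Every phase of a
-- round is linear in one of these lengths, so a round takes O(z) units, and
-- there are at most n rounds.
module Submission where

open import Data.Bool using (true; false; if_then_else_)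
open import Data.Fin using (Fin; inject₁)
open import Data.Fin.Permutation using (Permutation′; _⟨$⟩ʳ_)
open import Data.List using (List; []; _∷_; length; tabulate) renaming (lookup to lookupᴸ; map to mapᴸ)
open import Data.List.Properties using (length-map; length-tabulate)
open import Data.Nat using (ℕ; zero; suc; _+_; _*_; _/_; _≤_; _<ᵇ_; NonZero; z≤n; s≤s; _≤?_)
open import Data.Nat.Properties
open import Data.Nat.Tactic.RingSolver using (solve-∀)
open import Data.Product using (_×_; _,_; ∃-syntax; proj₁; proj₂)
open import Data.Unit using (⊤; tt)
open import Relation.Binary.PropositionalEquality using (_≡_; refl; sym; cong; subst)
open import Relation.Nullary using (yes; no)
open import Defs

-- `_>>=_` computes on programs and is no constructor of `Prog`, so a run of a composite is split by
-- induction on its first part.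
⇓-bind⁻¹ : ∀ {M} {A B : Set} (p : Prog A) {g : A → Prog B} {b t} → M ⊢ p >>= g ⇓ b ⟨ t ⟩ →
  ∃[ a ] ∃[ t₁ ] ∃[ t₂ ] (M ⊢ p ⇓ a ⟨ t₁ ⟩ × M ⊢ g a ⇓ b ⟨ t₂ ⟩ × t ≡ t₁ + t₂)
⇓-bind⁻¹ (return a) r = a , 0 , _ , return , r , refl
⇓-bind⁻¹ (charge i p) (charge r) with ⇓-bind⁻¹ p r
... | a , t₁ , t₂ , r₁ , r₂ , refl = a , _ , t₂ , charge r₁ , r₂ , sym (+-assoc _ t₁ t₂)
⇓-bind⁻¹ (uniform k {{k≢0}} f) (uniform i r) with ⇓-bind⁻¹ (f i) r
... | a , t₁ , t₂ , r₁ , r₂ , refl = a , _ , t₂ , uniform {{k≢0}} i r₁ , r₂ , sym (+-assoc _ t₁ t₂)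
⇓-bind⁻¹ (permute N f) (permute π r) with ⇓-bind⁻¹ (f π) r
... | a , t₁ , t₂ , r₁ , r₂ , refl = a , _ , t₂ , permute π r₁ , r₂ , sym (+-assoc _ t₁ t₂)

-- The continuation of `total` in `rss`, recovered by unification because it
-- mentions a function local to Defs.
rss-continuation : ∀ {A : Set} (m : ℕ) .{{_ : NonZero m}} (bag : List (A × ℕ)) →
  ∃[ g ] rss m bag ≡ (total bag >>= g)
rss-continuation m bag = _ , refl

-- The factor `suc N` rather than `N` leaves one unit for the shuffle of an empty list, whose cost
-- need not be 0.
record TimeUnit (M : CostModel) : Set where
  private module M = CostModel M
  field
    unit     : ℕ
    instr≤   : ∀ i → M.instr i ≤ unit
    draw≤    : M.draw ≤ unit
    shuffle≤ : ∀ N → M.shuffle N ≤ suc N * unit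

timeUnit : (M : CostModel) → TimeUnit M
timeUnit M = record
  { unit     = K
  ; instr≤   = λ where
      edgeAccess    → m≤m+n _ _
      counterAccess → m≤n⇒m≤o+n e (m≤m+n _ _)
      append        → m≤n⇒m≤o+n e (m≤n⇒m≤o+n a (m≤m+n _ _))
      elementary    → m≤n⇒m≤o+n e (m≤n⇒m≤o+n a (m≤n⇒m≤o+n p (m≤m+n _ _)))
  ; draw≤    = m≤n⇒m≤o+n e (m≤n⇒m≤o+n a (m≤n⇒m≤o+n p (m≤n⇒m≤o+n l (m≤m+n _ _))))
  ; shuffle≤ = λ where
      -- The linear bound starts at one element; the summand `M.shuffle 0` of `K` covers this case.
      zero    → ≤-trans (m≤n⇒m≤o+n e (m≤n⇒m≤o+n a (m≤n⇒m≤o+n p (m≤n⇒m≤o+n l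
                  (m≤n⇒m≤o+n d (m≤m+n _ _)))))) (m≤m+n K 0)
      (suc N) → ≤-trans (proj₂ M.shuffle-linear (suc N) (s≤s z≤n))
                (≤-trans (*-monoˡ-≤ (suc N) c≤K)
                (≤-trans (≤-reflexive (*-comm K (suc N))) (m≤n+m _ K)))
  }
  where
  module M = CostModel M
  e = M.instr edgeAccess
  a = M.instr counterAccess
  p = M.instr append
  l = M.instr elementary
  d = M.draw
  c = proj₁ M.shuffle-linear
  K = e + (a + (p + (l + (d + (M.shuffle 0 + c)))))
  c≤K : c ≤ K
  c≤K = m≤n⇒m≤o+n e (m≤n⇒m≤o+n a (m≤n⇒m≤o+n p (m≤n⇒m≤o+n l
          (m≤n⇒m≤o+n d (m≤n+m c (M.shuffle 0))))))

-- Time bounds combined with postconditions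

module _ {M : CostModel} (U : TimeUnit M) where
  open TimeUnit U

  -- The postcondition `P` carries the length of an output to the phase whose cost depends on it.
  record Within {A : Set} (n : ℕ) (P : A → Set) (p : Prog A) : Set where
    field
      bound : ∀ {a t} → M ⊢ p ⇓ a ⟨ t ⟩ → t ≤ n * unit × P a
  open Within

  private variable
    A B   : Set
    k m n : ℕ
    P Q   : A → Set

  weaken : {p : Prog A} → m ≤ n → Within m P p → Within n P p
  weaken m≤n w .bound r with w .bound r
  ... | t≤ , Pa = ≤-trans t≤ (*-monoˡ-≤ unit m≤n) , Pa

  map-within : {p : Prog A} → (∀ {a} → P a → Q a) → Within n P p → Within n Q p
  map-within f w .bound r with w .bound r
  ... | t≤ , Pa = t≤ , f Pa

  return-within : {a : A} → P a → Within n P (return a)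
  return-within Pa .bound return = z≤n , Pa

  charge-within : ∀ {i} {p : Prog A} → Within n P p → Within (suc n) P (charge i p)
  charge-within w .bound (charge {i = i} r) with w .bound r
  ... | t≤ , Pa = +-mono-≤ (instr≤ i) t≤ , Pa

  uniform-within : ∀ .{{_ : NonZero k}} {f : Fin k → Prog A} →
    (∀ i → Within n P (f i)) → Within (suc n) P (uniform k f)
  uniform-within w .bound (uniform i r) with w i .bound r
  ... | t≤ , Pa = +-mono-≤ draw≤ t≤ , Pa

  permute-within : ∀ {N f} → (∀ π → Within {A} n P (f π)) →
    Within (suc N + n) P (permute N f)
  permute-within {n = n} {N = N} w .bound (permute π r) with w π .bound r
  ... | t≤ , Pa = ≤-trans (+-mono-≤ (shuffle≤ N) t≤)
                    (≤-reflexive (sym (*-distribʳ-+ unit (suc N) n))) , Pa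

  -- The continuation's bound comes first so that recursive bounds such as
  -- 1 + l * 1 hold definitionally.
  bind-within : {p : Prog A} {g : A → Prog B} → Within m Q p →
    (∀ {a} → Q a → Within n P (g a)) → Within (n + m) P (p >>= g)
  bind-within {m = m} {n = n} {p = p} w v .bound r with ⇓-bind⁻¹ p r
  ... | a , t₁ , t₂ , r₁ , r₂ , refl with w .bound r₁
  ... | t₁≤ , Qa with v Qa .bound r₂
  ... | t₂≤ , Pb = (begin
    t₁ + t₂             ≤⟨ +-mono-≤ t₁≤ t₂≤ ⟩
    m * unit + n * unit ≡⟨ *-distribʳ-+ unit m n ⟨
    (m + n) * unit      ≡⟨ cong (_* unit) (+-comm m n) ⟩
    (n + m) * unit      ∎) , Pb
    where open ≤-Reasoning

  -- Random systematic sampling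

  total-within : ∀ {l} (bag : List (A × ℕ)) → length bag ≤ l →
    Within l (λ _ → ⊤) (total bag)
  total-within []        _         = return-within tt
  total-within (_ ∷ bag) (s≤s len) =
    bind-within (total-within bag len) λ _ → charge-within (return-within tt)

  if-within : ∀ {b} {p q : Prog A} → Within n P p → Within n P q →
    Within n P (if b then p else q)
  if-within {b = true}  v w = v
  if-within {b = false} v w = w

  scan-within : ∀ {l} step r psum (bag : List (A × ℕ)) → length bag ≤ l →
    Within (l * 4) (λ out → length out ≤ l) (scan step r psum bag)
  scan-within step r psum []              _         = return-within z≤n
  scan-within step r psum ((x , d) ∷ bag) (s≤s len) =
    charge-within (charge-within (if-within
      (charge-within (bind-within (scan-within _ _ _ bag len) λ out≤ →
        charge-within (return-within (s≤s out≤))))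
      -- A miss saves the update of `r` and the append, hence the slack of 2.
      (weaken (m≤n+m _ 2) (map-within m≤n⇒m≤1+n (scan-within _ _ _ bag len)))))

  -- Each entry costs one unit in `total`, one in the shuffle and four in `scan`. The other 3 units
  -- are the division, the constant part of the shuffle and the draw.
  rss-within : ∀ {l} (m : ℕ) .{{_ : NonZero m}} (bag : List (A × ℕ)) → length bag ≤ l →
    Within (3 + l * 6) (λ out → length out ≤ l) (rss m bag)
  rss-within {A = A} {l = l} m bag len =
    weaken (≤-reflexive (arith l)) (bind-within (total-within bag len) λ {s} _ → after-total s)
    where
    arith : ∀ l → suc (suc l + suc (l * 4)) + l ≡ 3 + l * 6
    arith = solve-∀
    shuffled : Permutation′ (length bag) → Fin (length bag) → A × ℕ
    shuffled π i = lookupᴸ bag (π ⟨$⟩ʳ i)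
    after-total : ∀ s → Within (suc (suc l + suc (l * 4))) (λ out → length out ≤ l)
                          (proj₁ (rss-continuation m bag) s)
    -- The continuation reduces further only once the step is known to be zero or positive.
    after-total s with s / m
    ... | zero  = charge-within (weaken (+-monoˡ-≤ _ (s≤s len))
                    (permute-within λ π → return-within z≤n))
    ... | suc _ = charge-within (weaken (+-monoˡ-≤ _ (s≤s len)) (permute-within λ π →
                    uniform-within λ i → scan-within _ _ _ (tabulate (shuffled π))
                      (≤-trans (≤-reflexive (length-tabulate (shuffled π))) len)))

  -- One round, then the loop

  selectEdges-within : ∀ {k} z (G : Graph k) →
    Within (z * 3) (λ es → length es ≤ z) (selectEdges z G)
  selectEdges-within zero    G = return-within z≤n
  selectEdges-within (suc z) G = uniform-within λ _ → charge-within
    (bind-within (selectEdges-within z G) λ es≤ → charge-within (return-within (s≤s es≤)))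

  tally-within : ∀ {k b} (v : Fin k) st → length (proj₂ st) ≤ b →
    Within 4 (λ st′ → length (proj₂ st′) ≤ suc b) (tally v st)
  tally-within v st seen≤ = charge-within (charge-within (charge-within (if-within
    (charge-within (return-within (s≤s seen≤)))
    (return-within (m≤n⇒m≤1+n seen≤)))))

  -- Each edge tallies two vertices, at 4 units each. The bound `b` on the list so far is general
  -- because it grows along the recursion.
  tallyEdges-within : ∀ {k l b} (es : List (Edge k)) st →
    length es ≤ l → length (proj₂ st) ≤ b →
    Within (l * 8) (λ st′ → length (proj₂ st′) ≤ l * 2 + b) (tallyEdges es st)
  tallyEdges-within {l = l} [] st _ seen≤ = return-within (m≤n⇒m≤o+n (l * 2) seen≤)
  tallyEdges-within {l = suc l} {b} ((u , v) ∷ es) st (s≤s len) seen≤ =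
    weaken (≤-reflexive (arith₁ l))
      (bind-within (tally-within u st seen≤) λ {st₁} seen₁≤ →
        bind-within (tally-within v st₁ seen₁≤) λ {st₂} seen₂≤ →
          subst (λ c → Within (l * 8) (λ st′ → length (proj₂ st′) ≤ c) (tallyEdges es st₂))
            (arith₂ l b) (tallyEdges-within es st₂ len seen₂≤))
    where
    arith₁ : ∀ l → l * 8 + 4 + 4 ≡ 8 + l * 8
    arith₁ = solve-∀
    arith₂ : ∀ l b → l * 2 + (2 + b) ≡ 2 + l * 2 + b
    arith₂ = solve-∀

  collect-within : ∀ {k l} (vs : List (Fin k)) cs → length vs ≤ l →
    Within (l * 3) (λ r → length (proj₁ r) ≤ l) (collect vs cs)
  collect-within []       cs _         = return-within z≤n
  collect-within (v ∷ vs) cs (s≤s len) = charge-within (charge-within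
    (bind-within (collect-within vs _ len) λ bag≤ → charge-within (return-within (s≤s bag≤))))

  addEdges-within : ∀ {k l} (v : Fin k) us S → length us ≤ l →
    Within l (λ _ → ⊤) (addEdges v us S)
  addEdges-within v []       S _         = return-within tt
  addEdges-within v (u ∷ us) S (s≤s len) = charge-within (addEdges-within v us _ len)

  round-within : ∀ {k z} (S : State k) → 1 ≤ z →
    Within (z * 35) (λ _ → ⊤) (round z S)
  round-within {z = z} ⟨ G , cs ⟩ 1≤z = weaken (begin
      -- From right to left: selection, tally, collection, sampling, and the new vertex with its
      -- edges. The last three work on lists of length at most `z * 2`.
      suc (z * 2) + (3 + z * 2 * 6) + z * 2 * 3 + z * 8 + z * 3 ≡⟨ arith z ⟩
      -- The constant overhead of a round is absorbed here by `1 ≤ z`.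
      4 * 1 + z * 31 ≤⟨ +-monoˡ-≤ (z * 31) (*-monoʳ-≤ 4 1≤z) ⟩
      4 * z + z * 31 ≡⟨ arith′ z ⟩
      z * 35 ∎)
    (bind-within (selectEdges-within z G) λ {es} es≤ →
     bind-within (tallyEdges-within es (cs , []) es≤ z≤n) λ {(cs₁ , seen)} seen≤ →
     bind-within (collect-within seen cs₁
       (≤-trans seen≤ (≤-reflexive (+-identityʳ (z * 2))))) λ {(bag , cs₂)} bag≤ →
     bind-within (rss-within 2 bag bag≤) λ {pair} pair≤ →
     charge-within (addEdges-within _ (mapᴸ inject₁ pair) _
       (≤-trans (≤-reflexive (length-map inject₁ pair)) pair≤)))
    where
    open ≤-Reasoning
    arith : ∀ z → suc (z * 2) + (3 + z * 2 * 6) + z * 2 * 3 + z * 8 + z * 3 ≡ 4 * 1 + z * 31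
    arith = solve-∀
    arith′ : ∀ z → 4 * z + z * 31 ≡ z * 35
    arith′ = solve-∀

  -- Induction on `d`, a bound on the rounds left: a round adds one vertex, so `n ≤ d + k` persists
  -- as `d` drops by one.
  halts-within : ∀ {n z k} → 1 ≤ z → ∀ d (S : State k) → n ≤ d + k →
    HaltsWithin M n z S (d * (z * 36 * unit))
  halts-within 1≤z zero S n≤k = stop n≤k
  halts-within {n} {z} {k} 1≤z (suc d) S n≤ with n ≤? k
  ... | yes n≤k = stop n≤k
  ... | no  n≰k = loop (≰⇒> n≰k) λ r → _ ,
    +-monoˡ-≤ (d * (z * 36 * unit)) (proj₁ (step .bound r)) ,
    halts-within 1≤z d _ (≤-trans n≤ (≤-reflexive (sym (+-suc d k))))
    where
    step : Within (z * 36) (λ _ → ⊤) (eval (k <ᵇ n) >> round z S)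
    step = weaken (begin
        -- The extra unit is the loop test.
        1 + z * 35 ≤⟨ +-monoˡ-≤ (z * 35) 1≤z ⟩
        z + z * 35 ≡⟨ *-suc z 35 ⟨
        z * 36     ∎) (charge-within (round-within S 1≤z))
      where open ≤-Reasoning

theorem6 : (M : CostModel) →
    ∃[ C ] (∀ {k} (G₀ : Graph k) → Simple G₀ → Connected G₀ →
    ∀ (n z : ℕ) → 1 ≤ z →
    HaltsWithin M n z (start G₀) (C * (n * z)))
theorem6 M = 36 * unit , λ {k} G₀ _ _ n z 1≤z →
  subst (HaltsWithin M n z (start G₀)) (arith n z unit)
    -- Since `n ≤ n + k`, at most `n` rounds are left at the start, whatever the order `k` of `G₀`.
    (halts-within U 1≤z n (start G₀) (m≤m+n n k))
  where
  U = timeUnit M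
  open TimeUnit U using (unit)
  arith : ∀ n z u → n * (z * 36 * u) ≡ 36 * u * (n * z)
  arith = solve-∀
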